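{- Let $k\ge3$ be an integer, let $0<\alpha<1/(10k)$, let $n$ be sufficiently large (in terms of $k$ and $\alpha$), and let $t=2\lceil\alpha n\rceil$. Let $S_1,\dots,S_t$ be pairwise disjoint $(k-1)$-subsets of an $n$-element vertex set. Let $G$ be a $k$-graph obtained from the complete $k$-graph on this vertex set by retaining, for each $j\in\{1,\dots,t\}$, exactly $1+\lceil\alpha n\rceil$ edges containing $S_j$ and deleting all other edges containing $S_j$ (edges containing no $S_j$ are all kept). Then: (1) under every ordering of $V(G)$ (i.e. every identification of $V(G)$ with $[n]$), for every $A\in\binom{[n]}{k-2}$ and every integer $r$ with $1\le r<\min\{\min A,(n-k+2)/2\}$, we have $c_r(A)\ge r+\alpha n$; (2) there is no ordering of $V(G)$ (identification of $V(G)$ with $[n]$) under which $d(S)\ge\min\{\min S,(n-k+2)/2\}+1$ holds for every $S\in\binom{V(G)}{k-1}$.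
   Context: A $k$-graph is a $k$-uniform hypergraph, and $[n]=\{1,\dots,n\}$. For a $k$-graph $G$ and $S\subseteq V(G)$, $d(S)=|\{e\in E(G): S\subseteq e\}|$. For $A\in\binom{V(G)}{k-2}$, $c_1(A)\le c_2(A)\le\cdots\le c_{|V(G)|-k+2}(A)$ denotes the non-decreasing arrangement of the multiset $\{d(A\cup\{x\}) : x\in V(G)\setminus A\}$. Once $V(G)$ is identified with $[n]$, $\min A$ and $\min S$ denote the smallest elements of $A$ and $S$. Since $k\ge 3$, no edge contains two distinct sets $S_i,S_j$, so the construction is well defined (the choice of retained edges being arbitrary). -}

module Defs where

open import Data.Nat.Base as ℕ using (ℕ; zero; suc)
open import Data.Nat.Properties as ℕₚ using ()
open import Data.Integer.Base as ℤ using (ℤ)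
open import Data.Rational
  using (ℚ; _/_; _<_; _+_; _*_; _-_; -_; 0ℚ; 1ℚ; 1/_; Positive; _⊓_; _<?_)
open import Data.Rational.Properties
open import Data.Fin.Base using (Fin; toℕ)
open import Data.Fin.Permutation using (Permutation′; _⟨$⟩ʳ_)
open import Data.Fin.Subset using (Subset; _∈_; _⊆_; _∪_; _∩_; ∁; ⁅_⁆; ∣_∣; Empty)
open import Data.Fin.Subset.Properties using (_∈?_; _⊆?_)
open import Data.List.Base using (List; []; _∷_; length; filter; map; allFin)
open import Data.List.Extrema.Nat using (min)
import Data.List.Membership.Propositional as List
open import Data.List.Relation.Unary.All using (All)
open import Data.List.Relation.Unary.Unique.Propositional using (Unique)
open import Data.List.Sort ℕₚ.≤-decTotalOrder using (sort)
open import Data.Product.Base using (∃; ∃-syntax; _×_; _,_)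
open import Data.Sum.Base using (_⊎_; inj₁; inj₂)
open import Relation.Binary.Definitions using (tri<; tri≈; tri>)
open import Relation.Binary.PropositionalEquality
  using (_≡_; _≢_; refl; sym; trans; cong; subst)
open import Relation.Nullary using (¬_; yes; no; contradiction)

-- Real numbers, as two-sided Dedekind cuts: lower q means q < x and
-- upper q means x < q.

record ℝ : Set₁ where
  field
    lower upper     : ℚ → Set
    lower-inhabited : ∃ lower
    upper-inhabited : ∃ upper
    lower-closed    : ∀ {p q} → p < q → lower q → lower p
    upper-closed    : ∀ {p q} → p < q → upper p → upper q
    lower-open      : ∀ {p} → lower p → ∃[ q ] p < q × lower q
    upper-open      : ∀ {q} → upper q → ∃[ p ] p < q × upper p
    disjoint        : ∀ {q} → lower q → ¬ upper q
    located         : ∀ {p q} → p < q → lower p ⊎ upper q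

open ℝ public

infix 4 _≤ᴿ_ _<ᴿ_
infixl 6 _⊕_
infixl 7 _·_

_≤ᴿ_ : ℝ → ℝ → Set
x ≤ᴿ y = ∀ q → lower x q → lower y q

_<ᴿ_ : ℝ → ℝ → Set
x <ᴿ y = ∃[ q ] upper x q × lower y q

lower<upper : ∀ x {p q} → lower x p → upper x q → p < q
lower<upper x {p} {q} lp uq with <-cmp p q
... | tri< p<q _ _  = p<q
... | tri≈ _ refl _ = contradiction uq (disjoint x lp)
... | tri> _ _ q<p  = contradiction (upper-closed x q<p uq) (disjoint x lp)

fromℕ : ℕ → ℚ
fromℕ n = ℤ.+ n / 1

fromℕ-pos : ∀ n → Positive (fromℕ (suc n))
fromℕ-pos n = normalize-pos (suc n) 1

private
  q-1<q : ∀ q → q - 1ℚ < q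
  q-1<q q = subst (q - 1ℚ <_) (+-identityʳ q) (+-monoʳ-< q (negative⁻¹ (- 1ℚ)))

  q<q+1 : ∀ q → q < q + 1ℚ
  q<q+1 q = subst (_< q + 1ℚ) (+-identityʳ q) (+-monoʳ-< q (positive⁻¹ 1ℚ))

  p+q-q : ∀ p q → p + q - q ≡ p
  p+q-q p q = trans (+-assoc p q (- q))
    (trans (cong (p +_) (+-inverseʳ q)) (+-identityʳ p))

  p-q+q : ∀ p q → p - q + q ≡ p
  p-q+q p q = trans (+-assoc p (- q) q)
    (trans (cong (p +_) (+-inverseˡ q)) (+-identityʳ p))

fromℚ : ℚ → ℝ
fromℚ x .lower q = q < x
fromℚ x .upper q = x < q
fromℚ x .lower-inhabited = x - 1ℚ , q-1<q x
fromℚ x .upper-inhabited = x + 1ℚ , q<q+1 x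
fromℚ x .lower-closed = <-trans
fromℚ x .upper-closed p<q x<p = <-trans x<p p<q
fromℚ x .lower-open p<x = <-dense p<x
fromℚ x .upper-open x<q with r , x<r , r<q ← <-dense x<q = r , r<q , x<r
fromℚ x .disjoint q<x x<q = <-asym q<x x<q
fromℚ x .located {p} p<q with p <? x
... | yes p<x = inj₁ p<x
... | no  p≮x = inj₂ (≤-<-trans (≮⇒≥ p≮x) p<q)

-- The real number r + x.
_⊕_ : ℚ → ℝ → ℝ
(r ⊕ x) .lower q = lower x (q - r)
(r ⊕ x) .upper q = upper x (q - r)
(r ⊕ x) .lower-inhabited with p , lp ← lower-inhabited x =
  p + r , subst (lower x) (sym (p+q-q p r)) lp
(r ⊕ x) .upper-inhabited with p , up ← upper-inhabited x =
  p + r , subst (upper x) (sym (p+q-q p r)) up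
(r ⊕ x) .lower-closed p<q = lower-closed x (+-monoˡ-< (- r) p<q)
(r ⊕ x) .upper-closed p<q = upper-closed x (+-monoˡ-< (- r) p<q)
(r ⊕ x) .lower-open {p} lp with q , p-r<q , lq ← lower-open x lp =
  q + r
  , subst (_< q + r) (p-q+q p r) (+-monoˡ-< r p-r<q)
  , subst (lower x) (sym (p+q-q q r)) lq
(r ⊕ x) .upper-open {q} uq with p , p<q-r , up ← upper-open x uq =
  p + r
  , subst (p + r <_) (p-q+q q r) (+-monoˡ-< r p<q-r)
  , subst (upper x) (sym (p+q-q p r)) up
(r ⊕ x) .disjoint = disjoint x
(r ⊕ x) .located p<q = located x (+-monoˡ-< (- r) p<q)

private
  ·-located : ∀ n x {p q} → p < q →
    (∃[ a ] lower x a × p < a * fromℕ n) ⊎ (∃[ b ] upper x b × b * fromℕ n < q)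
  ·-located zero x {p} {q} p<q with p <? 0ℚ
  ... | yes p<0 with a , la ← lower-inhabited x =
    inj₁ (a , la , subst (p <_) (sym (*-zeroʳ a)) p<0)
  ... | no p≮0 with b , ub ← upper-inhabited x =
    inj₂ (b , ub , subst (_< q) (sym (*-zeroʳ b)) (≤-<-trans (≮⇒≥ p≮0) p<q))
  ·-located (suc n) x {p} {q} p<q = go
    where
    N = fromℕ (suc n)
    instance
      N-pos = fromℕ-pos n
      N≢0 = pos⇒nonZero N
      1/N-pos = 1/pos⇒pos N

    cancel : ∀ s → s * 1/ N * N ≡ s
    cancel s = trans (*-assoc s (1/ N) N)
      (trans (cong (s *_) (*-inverseˡ N)) (*-identityʳ s))

    go : (∃[ a ] lower x a × p < a * N) ⊎ (∃[ b ] upper x b × b * N < q)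
    go with located x (*-monoˡ-<-pos (1/ N) p<q)
    ... | inj₁ l with a , <a , la ← lower-open x l =
      inj₁ (a , la , subst (_< a * N) (cancel p) (*-monoˡ-<-pos N <a))
    ... | inj₂ u with b , b< , ub ← upper-open x u =
      inj₂ (b , ub , subst (b * N <_) (cancel q) (*-monoˡ-<-pos N b<))

  ·-mono : ∀ n {a b} → a < b → ¬ (b * fromℕ n < a * fromℕ n)
  ·-mono zero {a} {b} _ lt = <-irrefl (trans (*-zeroʳ b) (sym (*-zeroʳ a))) lt
  ·-mono (suc n) a<b lt =
    <-asym lt (*-monoˡ-<-pos (fromℕ (suc n)) {{fromℕ-pos n}} a<b)

-- The real number x n.
_·_ : ℝ → ℕ → ℝ
(x · n) .lower q = ∃[ a ] lower x a × q < a * fromℕ n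
(x · n) .upper q = ∃[ b ] upper x b × b * fromℕ n < q
(x · n) .lower-inhabited with a , la ← lower-inhabited x =
  a * fromℕ n - 1ℚ , a , la , q-1<q _
(x · n) .upper-inhabited with b , ub ← upper-inhabited x =
  b * fromℕ n + 1ℚ , b , ub , q<q+1 _
(x · n) .lower-closed p<q (a , la , q<) = a , la , <-trans p<q q<
(x · n) .upper-closed p<q (b , ub , <p) = b , ub , <-trans <p p<q
(x · n) .lower-open (a , la , p<) with r , p<r , r< ← <-dense p< =
  r , p<r , a , la , r<
(x · n) .upper-open (b , ub , <q) with r , <r , r<q ← <-dense <q =
  r , r<q , b , ub , <r
(x · n) .disjoint (a , la , q<) (b , ub , <q) =
  ·-mono n (lower<upper x la ub) (<-trans <q q<)
(x · n) .located = ·-located n x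

-- m = ⌈x⌉.  This is a relation because the ceiling of a real number is not
-- computable.  Only x > 0 is needed, so m ranges over ℕ.
IsCeiling : ℝ → ℕ → Set
IsCeiling x m = x ≤ᴿ fromℚ (fromℕ m) × fromℚ (fromℕ m) <ᴿ 1ℚ ⊕ x

1/10·_by_ : ∀ k → 3 ℕ.≤ k → ℚ
1/10· k@(suc _) by _ = ℤ.+ 1 / (10 ℕ.* k)

-- The edge set is a repetition-free list of k-subsets of the vertex set Fin n.
record KGraph (k n : ℕ) : Set where
  field
    edges   : List (Subset n)
    unique  : Unique edges
    uniform : All (λ e → ∣ e ∣ ≡ k) edges

open KGraph public

degree : ∀ {k n} → KGraph k n → Subset n → ℕ
degree G S = length (filter (S ⊆?_) (edges G))

elements : ∀ {n} → Subset n → List (Fin n)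
elements {n} A = filter (_∈? A) (allFin n)

-- 1-indexed; the value 0 at indices out of range is never relevant.
nth : List ℕ → ℕ → ℕ
nth []       _             = 0
nth (x ∷ xs) 0             = 0
nth (x ∷ xs) 1             = x
nth (x ∷ xs) (suc (suc r)) = nth xs (suc r)

-- c G r A is c_r(A); the vertices outside A are the elements of ∁ A.
c : ∀ {k n} → KGraph k n → ℕ → Subset n → ℕ
c G r A = nth (sort (map (λ x → degree G (A ∪ ⁅ x ⁆)) (elements (∁ A)))) r

-- An identification of the vertex set Fin n with [n] is a permutation π of
-- Fin n, under which v receives the label 1 + toℕ (π v) ∈ [n].
label : ∀ {n} → Permutation′ n → Fin n → ℕ
label π v = suc (toℕ (π ⟨$⟩ʳ v))

-- All labels are at most n, so the default value n of min does not affect the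
-- result when A is nonempty.
minLabel : ∀ {n} → Permutation′ n → Subset n → ℕ
minLabel {n} π A = min n (map (label π) (elements A))

-- Integer subtraction, so that n - k + 2 is not truncated.
cap : (k n m : ℕ) → ℚ
cap k n m = fromℕ m ⊓ ((ℤ.+ n ℤ.- ℤ.+ k ℤ.+ ℤ.+ 2) / 2)

-- G arises from the complete k-graph on Fin n by retaining, for each j,
-- exactly d of the edges containing S j, and all edges containing no S j.
record Retains {k n t : ℕ} (S : Fin t → Subset n) (d : ℕ) (G : KGraph k n) : Set where
  field
    kept     : ∀ e → ∣ e ∣ ≡ k → (∀ j → ¬ (S j ⊆ e)) → e List.∈ edges G
    retained : ∀ j → degree G (S j) ≡ d

PairwiseDisjoint : ∀ {n t} → (Fin t → Subset n) → Set
PairwiseDisjoint S = ∀ i j → i ≢ j → Empty (S i ∩ S j)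

{-# OPTIONS --safe #-}
-- Write m = ⌈αn⌉, so that t = 2m.
-- (1) A (k-1)-set T that is not some S_j lies in all but at most k-1 of the
-- possible edges T ∪ {y}: if S_j ⊆ T ∪ {y}, then S_j meets T and, the S_j being
-- disjoint, each vertex of T determines j and hence y.  By disjointness again,
-- at most one x makes A ∪ {x} some S_j, and then the degree is m+1.  Hence
-- c_1(A) ≥ m+1, and c_r(A) ≥ n-2k+2 ≥ r+m for r ≥ 2.
-- (2) Disjoint sets have distinct minimal labels, so some S_j among the 2m has
-- minimal label above m, while its degree is only m+1.
module Submission where

open import Defs

module Combinatorics where

  open import Data.Nat.Properties
  open import Data.Fin.Base as Fin using (Fin; toℕ)
  open import Data.Fin.Permutation using (Permutation′; _⟨$⟩ʳ_; _⟨$⟩ˡ_; inverseˡ)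
  import Data.Fin.Properties as Fin
  open import Data.Fin.Subset
    using (Subset; inside; outside; _∈_; _∉_; _⊆_; _∪_; _∩_; ∁; ⁅_⁆; ∣_∣)
  open import Data.Fin.Subset.Properties
  open import Data.List.Base using (List; []; _∷_; _++_; length; filter; map; lookup; tabulate; allFin)
  open import Data.List.Extrema ≤-totalOrder using (argmin-sel)
  open import Data.List.Membership.Propositional renaming (_∈_ to _∈ₗ_) using ()
  open import Data.List.Membership.Propositional.Properties
  open import Data.List.Membership.Setoid.Properties using (index-injective)
  open import Data.List.Properties
    using (length-map; length-++; filter-≐; filter-accept; filter-some; map-tabulate)
  open import Data.List.Relation.Binary.Permutation.Propositional.Properties using (↭-length; filter-↭)
  open import Data.List.Relation.Unary.All as All using ([]; _∷_)
  open import Data.List.Relation.Unary.AllPairs using (AllPairs; []; _∷_)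
  open import Data.List.Relation.Unary.Any as Any using (here; there)
  open import Data.List.Relation.Unary.Sorted.TotalOrder.Properties using (Sorted⇒AllPairs)
  open import Data.List.Relation.Unary.Unique.Propositional using (Unique)
  open import Data.List.Relation.Unary.Unique.Propositional.Properties using (allFin⁺; filter⁺)
  open import Data.List.Sort ≤-decTotalOrder using (sort; sort-↭; sort-↗)
  open import Data.Nat.Base using (ℕ; zero; suc; _≤_; _<_; _+_; _*_; _∸_; z≤n; s≤s)
  open import Data.Nat.Solver using (module +-*-Solver)
  open import Data.Product.Base using (∃-syntax; _×_; _,_; proj₁; proj₂)
  open import Data.Sum.Base using (_⊎_; inj₁; inj₂)
  open import Data.Vec using ([]; _∷_; here; there)
  open import Function.Base using (_∘_; id)
  open import Level using (Level)
  open import Relation.Binary.PropositionalEquality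
  open import Relation.Nullary using (¬_; yes; no; contradiction)
  open import Relation.Unary using (Pred; Decidable)

  private
    variable
      a b p : Level
      X : Set a
      Y : Set b
      n : ℕ

  -- Counting in finite lists and finite subsets.

  Unique⇒lookup-≢ : {xs : List X} → Unique xs → ∀ {i j} → i Fin.< j → lookup xs i ≢ lookup xs j
  Unique⇒lookup-≢ {xs = _ ∷ _}  (x≢ ∷ _) {Fin.zero}  {Fin.suc j} _ = All.lookup x≢ (∈-lookup j)
  Unique⇒lookup-≢ {xs = _ ∷ _} (_ ∷ u) {Fin.suc i} {Fin.suc j} (s≤s i<j) = Unique⇒lookup-≢ u i<j

  -- Pigeonhole on positions: if `ys` were shorter, two positions of `xs` would choose the same
  -- position of `ys`. With a relation instead of a function, injectivity is argued from what `R`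
  -- says, without unfolding the case analysis that selects the image.
  injectiveRelation⇒length≤ : {xs : List X} {ys : List Y} (R : X → Y → Set) → Unique xs →
    (∀ {x} → x ∈ₗ xs → ∃[ y ] y ∈ₗ ys × R x y) →
    (∀ {x x′ y} → x ∈ₗ xs → x′ ∈ₗ xs → R x y → R x′ y → x ≡ x′) →
    length xs ≤ length ys
  injectiveRelation⇒length≤ {X = X} {Y = Y} {xs = xs} {ys = ys} R unq total inj = ≮⇒≥ λ ys<xs →
    let image i                  = total (∈-lookup i)
        i , j , i<j , same-index = Fin.pigeonhole ys<xs (λ i → Any.index (proj₁ (proj₂ (image i))))
        _ , y∈ , Ry              = image i
        _ , y′∈ , Ry′            = image j
        y≡y′                     = index-injective (setoid Y) y∈ y′∈ same-index
    in Unique⇒lookup-≢ unq i<j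
         (inj (∈-lookup i) (∈-lookup j) (subst (R (lookup xs i)) y≡y′ Ry) Ry′)

  length-filter-map : {P : Pred Y p} (P? : Decidable P) (f : X → Y) (xs : List X) →
    length (filter P? (map f xs)) ≡ length (filter (P? ∘ f) xs)
  length-filter-map P? f []       = refl
  length-filter-map P? f (x ∷ xs) with P? (f x)
  ... | yes _ = cong suc (length-filter-map P? f xs)
  ... | no  _ = length-filter-map P? f xs

  length-elements : (A : Subset n) → length (elements A) ≡ ∣ A ∣
  length-elements []      = refl
  length-elements {suc n} (b ∷ A) = head b
    where
    tail : ∀ b → length (filter (_∈? (b ∷ A)) (tabulate Fin.suc)) ≡ ∣ A ∣
    tail b = begin
      length (filter (_∈? (b ∷ A)) (tabulate Fin.suc))
        ≡⟨ cong (length ∘ filter (_∈? (b ∷ A))) (map-tabulate id Fin.suc) ⟨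
      length (filter (_∈? (b ∷ A)) (map Fin.suc (allFin n)))
        ≡⟨ length-filter-map (_∈? (b ∷ A)) Fin.suc (allFin n) ⟩
      length (filter (λ x → Fin.suc x ∈? (b ∷ A)) (allFin n))
        ≡⟨ cong length (filter-≐ (λ x → Fin.suc x ∈? (b ∷ A)) (_∈? A)
             ((λ where (there x∈A) → x∈A) , there) (allFin n)) ⟩
      length (elements A)
        ≡⟨ length-elements A ⟩
      ∣ A ∣ ∎
      where open ≡-Reasoning
    head : ∀ c → length (filter (_∈? (c ∷ A)) (allFin (suc n))) ≡ ∣ c ∷ A ∣
    head inside  = cong suc (tail inside)
    head outside = tail outside

  nth∈ : ∀ xs {r} → 1 ≤ r → r ≤ length xs → nth xs r ∈ₗ xs
  nth∈ (x ∷ xs) {suc zero}    _ _         = here refl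
  nth∈ (x ∷ xs) {suc (suc r)} _ (s≤s r≤n) = there (nth∈ xs (s≤s z≤n) r≤n)

  -- In a sorted list the entries before the `r`-th are no larger than it, so the first `r` entries
  -- all lie below `D`.
  nth<⇒≤length-filter : ∀ {xs} → AllPairs _≤_ xs → ∀ D {r} → 1 ≤ r → r ≤ length xs →
    nth xs r < D → r ≤ length (filter (_<? D) xs)
  nth<⇒≤length-filter {x ∷ xs} _ D {suc zero} _ _ x<D = filter-some (_<? D) (here x<D)
  nth<⇒≤length-filter {x ∷ xs} (x≤ ∷ sorted) D {suc (suc r)} _ (s≤s r≤n) nth<D
    rewrite filter-accept (_<? D) {xs = xs}
              (≤-<-trans (All.lookup x≤ (nth∈ xs (s≤s z≤n) r≤n)) nth<D)
    = s≤s (nth<⇒≤length-filter sorted D (s≤s z≤n) r≤n nth<D)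

  ∣p∪⁅x⁆∣ : ∀ {x : Fin n} {q} → x ∉ q → ∣ q ∪ ⁅ x ⁆ ∣ ≡ suc ∣ q ∣
  ∣p∪⁅x⁆∣ {x = Fin.zero}  {inside  ∷ q} x∉ = contradiction here x∉
  ∣p∪⁅x⁆∣ {x = Fin.zero}  {outside ∷ q} x∉ = cong (suc ∘ ∣_∣) (∪-identityʳ q)
  ∣p∪⁅x⁆∣ {x = Fin.suc x} {inside  ∷ q} x∉ = cong suc (∣p∪⁅x⁆∣ (x∉ ∘ there))
  ∣p∪⁅x⁆∣ {x = Fin.suc x} {outside ∷ q} x∉ = ∣p∪⁅x⁆∣ (x∉ ∘ there)

  ⊆∧∣∣≥⇒≡ : ∀ {s q : Subset n} → s ⊆ q → ∣ q ∣ ≤ ∣ s ∣ → s ≡ q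
  ⊆∧∣∣≥⇒≡ {s = s} {q} s⊆q q≤s = ⊆-antisym s⊆q q⊆s
    where
    q⊆s : q ⊆ s
    q⊆s {x} x∈q with x ∈? s
    ... | yes x∈s = x∈s
    ... | no  x∉s = contradiction q≤s (<⇒≱ (p⊂q⇒∣p∣<∣q∣ (s⊆q , x , x∈q , x∉s)))

  ∈-elements⁻ : ∀ {n} {A : Subset n} {x} → x ∈ₗ elements A → x ∈ A
  ∈-elements⁻ {n} {A} = proj₂ ∘ ∈-filter⁻ (_∈? A) {xs = allFin n}

  ∈-elements⁺ : ∀ {n} {A : Subset n} {x} → x ∈ A → x ∈ₗ elements A
  ∈-elements⁺ {A = A} {x} = ∈-filter⁺ (_∈? A) (∈-allFin x)

  Unique-elements : ∀ {n} (A : Subset n) → Unique (elements A)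
  Unique-elements {n} A = filter⁺ (_∈? A) (allFin⁺ n)

  x∈p∪⁅y⁆∧x∉p⇒x≡y : ∀ {n} {A : Subset n} {x y} → x ∈ A ∪ ⁅ y ⁆ → x ∉ A → x ≡ y
  x∈p∪⁅y⁆∧x∉p⇒x≡y {A = A} {y = y} x∈ x∉A with x∈p∪q⁻ A ⁅ y ⁆ x∈
  ... | inj₁ x∈A = contradiction x∈A x∉A
  ... | inj₂ x∈y = x∈⁅y⁆⇒x≡y y x∈y

  s⊆p∪⁅y⁆∧y∉s⇒s⊆p : ∀ {n} {s A : Subset n} {y} → s ⊆ A ∪ ⁅ y ⁆ → y ∉ s → s ⊆ A
  s⊆p∪⁅y⁆∧y∉s⇒s⊆p {A = A} {y} s⊆ y∉s {z} z∈s with z ∈? A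
  ... | yes z∈A = z∈A
  ... | no  z∉A = contradiction (subst (_∈ _) (x∈p∪⁅y⁆∧x∉p⇒x≡y (s⊆ z∈s) z∉A) z∈s) y∉s

  -- Sorting only permutes the entries. A small c_r(A) thus becomes a count of at least r low-degree
  -- extensions of A, with no order left.
  nth-sort<⇒≤length-filter : ∀ (xs : List ℕ) D {r} → 1 ≤ r → r ≤ length xs → nth (sort xs) r < D →
    r ≤ length (filter (_<? D) xs)
  nth-sort<⇒≤length-filter xs D {r} 1≤r r≤n nth<D = subst (r ≤_) (↭-length (filter-↭ (_<? D) (sort-↭ xs)))
    (nth<⇒≤length-filter (Sorted⇒AllPairs ≤-totalOrder (sort-↗ xs)) D 1≤r
      (subst (r ≤_) (sym (↭-length (sort-↭ xs))) r≤n) nth<D)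

  -- Degrees in the thinned complete hypergraph, with k = 3 + `p`.

  module _ {p n t d} (S : Fin t → Subset n) (∣S∣≡ : ∀ j → ∣ S j ∣ ≡ 2 + p)
    (disjointS : PairwiseDisjoint S) (G : KGraph (3 + p) n) (retains : Retains S d G) where

    open Retains retains

    common⇒≡ : ∀ {i j v} → v ∈ S i → v ∈ S j → i ≡ j
    common⇒≡ {i} {j} {v} v∈i v∈j with i Fin.≟ j
    ... | yes i≡j = i≡j
    ... | no  i≢j = contradiction (v , x∈p∩q⁺ (v∈i , v∈j)) (disjointS i j i≢j)

    -- The error term counts `T` twice: once for its own vertices, and once for the outside vertices
    -- `y` with a blocked edge `T ∪ ⁅ y ⁆`, each charged to a vertex of `T`.
    degree-lower-bound : ∀ T → ∣ T ∣ ≡ 2 + p → (∀ j → ¬ (S j ⊆ T)) → n ≤ degree G T + 2 * (2 + p)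
    degree-lower-bound T ∣T∣≡ S⊈T = begin
      n                                  ≤⟨ m≤n+m∸n n ∣ T ∣ ⟩
      ∣ T ∣ + (n ∸ ∣ T ∣)                ≡⟨ cong (∣ T ∣ +_) (trans (length-elements (∁ T)) (∣∁p∣≡n∸∣p∣ T)) ⟨
      ∣ T ∣ + length (elements (∁ T))    ≤⟨ +-monoʳ-≤ ∣ T ∣
        (injectiveRelation⇒length≤ R (Unique-elements (∁ T)) total injective) ⟩
      ∣ T ∣ + length codomain            ≡⟨ cong (∣ T ∣ +_) length-codomain ⟩
      ∣ T ∣ + (degree G T + ∣ T ∣)       ≡⟨ cong (λ u → u + (degree G T + u)) ∣T∣≡ ⟩
      2 + p + (degree G T + (2 + p))     ≡⟨
        solve 2 (λ q e → q :+ (e :+ q) := e :+ con 2 :* q) refl (2 + p) (degree G T) ⟩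
      degree G T + 2 * (2 + p)           ∎
      where
      open ≤-Reasoning
      open +-*-Solver
      codomain : List (Subset n ⊎ Fin n)
      codomain = map inj₁ (filter (T ⊆?_) (edges G)) ++ map inj₂ (elements T)

      length-codomain : length codomain ≡ degree G T + ∣ T ∣
      length-codomain = trans (length-++ (map inj₁ (filter (T ⊆?_) (edges G))))
        (cong₂ _+_ (length-map inj₁ (filter (T ⊆?_) (edges G)))
          (trans (length-map inj₂ (elements T)) (length-elements T)))

      -- An outside vertex goes to its edge through `T`, or to a vertex of `T` lying in the same
      -- blocking `S j`.
      R : Fin n → Subset n ⊎ Fin n → Set
      R y (inj₁ e) = e ≡ T ∪ ⁅ y ⁆
      R y (inj₂ z) = ∃[ j ] y ∈ S j × z ∈ S j × S j ⊆ T ∪ ⁅ y ⁆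

      total : ∀ {y} → y ∈ₗ elements (∁ T) → ∃[ w ] w ∈ₗ codomain × R y w
      total {y} y∈ with Fin.any? (λ j → S j ⊆? T ∪ ⁅ y ⁆)
      ... | no none = inj₁ (T ∪ ⁅ y ⁆)
          , ∈-++⁺ˡ (∈-map⁺ inj₁ (∈-filter⁺ (T ⊆?_)
              (kept _ (trans (∣p∪⁅x⁆∣ (x∈∁p⇒x∉p (∈-elements⁻ y∈))) (cong suc ∣T∣≡))
                (λ j S⊆ → none (j , S⊆)))
              (p⊆p∪q ⁅ y ⁆)))
          , refl
      ... | yes (j , S⊆) with nonempty? (S j ∩ T) | y ∈? S j
      ...   | _ | no y∉S = contradiction (λ {x} → s⊆p∪⁅y⁆∧y∉s⇒s⊆p S⊆ y∉S {x}) (S⊈T j)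
      ...   | yes (z , z∈) | yes y∈S = inj₂ z
          , ∈-++⁺ʳ _ (∈-map⁺ inj₂ (∈-elements⁺ (proj₂ (x∈p∩q⁻ (S j) T z∈))))
          , j , y∈S , proj₁ (x∈p∩q⁻ (S j) T z∈) , S⊆
      -- A blocking `S j` that misses `T` would lie in a singleton, but it has k - 1 ≥ 2 vertices.
      ...   | no empty | yes _ = contradiction (p⊆q⇒∣p∣≤∣q∣ S⊆⁅y⁆)
          (<⇒≱ (subst₂ _<_ (sym (∣⁅x⁆∣≡1 y)) (sym (∣S∣≡ j)) (s≤s (s≤s z≤n))))
        where
        S⊆⁅y⁆ : S j ⊆ ⁅ y ⁆
        S⊆⁅y⁆ z∈S = subst (_∈ ⁅ y ⁆)
          (sym (x∈p∪⁅y⁆∧x∉p⇒x≡y (S⊆ z∈S) (λ z∈T → empty (_ , x∈p∩q⁺ (z∈S , z∈T))))) (x∈⁅x⁆ y)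

      injective : ∀ {x y w} → x ∈ₗ elements (∁ T) → y ∈ₗ elements (∁ T) → R x w → R y w → x ≡ y
      injective {x} {y} {inj₁ e} x∈ y∈ e≡x e≡y = x∈p∪⁅y⁆∧x∉p⇒x≡y
        (subst (x ∈_) (trans (sym e≡x) e≡y) (q⊆p∪q T ⁅ x ⁆ (x∈⁅x⁆ x))) (x∈∁p⇒x∉p (∈-elements⁻ x∈))
      -- The shared vertex `z` identifies the two blocking sets, so `x` lies in `T ∪ ⁅ y ⁆` but not
      -- in `T`.
      injective {x} {y} {inj₂ z} x∈ y∈ (i , x∈Si , z∈Si , _) (j , _ , z∈Sj , Sj⊆)
        with refl ← common⇒≡ z∈Si z∈Sj = x∈p∪⁅y⁆∧x∉p⇒x≡y (Sj⊆ x∈Si) (x∈∁p⇒x∉p (∈-elements⁻ x∈))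

    -- By `degree-lower-bound`, so low a degree forces some `S j` inside `A ∪ ⁅ x ⁆`; both sets have
    -- k - 1 vertices, hence coincide.
    low-degree⇒S : ∀ {A x} → ∣ A ∣ ≡ 1 + p → x ∉ A → degree G (A ∪ ⁅ x ⁆) + 2 * (2 + p) < n →
      ∃[ j ] S j ≡ A ∪ ⁅ x ⁆
    low-degree⇒S {A} {x} ∣A∣≡ x∉A low with Fin.any? (λ j → S j ⊆? A ∪ ⁅ x ⁆)
    ... | yes (j , S⊆) = j , ⊆∧∣∣≥⇒≡ S⊆ (≤-reflexive
            (trans (∣p∪⁅x⁆∣ x∉A) (trans (cong suc ∣A∣≡) (sym (∣S∣≡ j)))))
    ... | no none = contradiction
            (degree-lower-bound (A ∪ ⁅ x ⁆) (trans (∣p∪⁅x⁆∣ x∉A) (cong suc ∣A∣≡))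
              (λ j S⊆ → none (j , S⊆)))
            (<⇒≱ low)

    -- Since k - 2 ≥ 1, `A` has a vertex; it lies in both `S i` and `S j`, so disjointness gives
    -- `i ≡ j`.
    S-completion-unique : ∀ {A x y i j} → ∣ A ∣ ≡ 1 + p → x ∉ A →
      S i ≡ A ∪ ⁅ x ⁆ → S j ≡ A ∪ ⁅ y ⁆ → x ≡ y
    S-completion-unique {A} {x} {y} ∣A∣≡ x∉A Si≡ Sj≡ with nonempty? A
    ... | no empty = contradiction
            (trans (sym ∣A∣≡) (trans (cong ∣_∣ (Empty-unique empty)) (∣⊥∣≡0 n))) λ()
    ... | yes (v , v∈A)
      with refl ← common⇒≡ (subst (v ∈_) (sym Si≡) (p⊆p∪q ⁅ x ⁆ v∈A))
                          (subst (v ∈_) (sym Sj≡) (p⊆p∪q ⁅ y ⁆ v∈A))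
      = x∈p∪⁅y⁆∧x∉p⇒x≡y (subst (x ∈_) (trans (sym Si≡) Sj≡) (q⊆p∪q A ⁅ x ⁆ (x∈⁅x⁆ x))) x∉A

    -- If c_r(A) < r + m, then at least r vertices complete `A` to some `S j`. At most one vertex
    -- does, and its degree m + 1 is not below the threshold when r = 1.
    c-lower-bound : ∀ {A m r} → d ≡ suc m → ∣ A ∣ ≡ 1 + p → 1 ≤ r → r + m + 2 * (2 + p) ≤ n →
      r + m ≤ c G r A
    c-lower-bound {A} {m} {r} refl ∣A∣≡ 1≤r D≤n = ≮⇒≥ λ c<D → few lows
        (filter⁺ low? (Unique-elements (∁ A)))
        (λ x∈ → let x∈∁A , fx<D = ∈-filter⁻ low? {xs = elements (∁ A)} x∈
                in x∈∁p⇒x∉p (∈-elements⁻ x∈∁A) , fx<D)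
        (subst (r ≤_) (length-filter-map (_<? r + m) f (elements (∁ A)))
          (nth-sort<⇒≤length-filter (map f (elements (∁ A))) (r + m) 1≤r r≤length c<D))
      where
      f : Fin n → ℕ
      f x = degree G (A ∪ ⁅ x ⁆)
      low? = λ x → f x <? r + m
      lows = filter low? (elements (∁ A))

      -- The rank must point to an actual entry, because `nth` returns 0 past the end of the list.
      r≤length : r ≤ length (map f (elements (∁ A)))
      r≤length = begin
        r                                ≤⟨ m+n≤o⇒m≤o∸n r (begin
          r + (1 + p)                    ≤⟨ +-mono-≤ (m≤m+n r m) (≤-trans (n≤1+n (1 + p)) (m≤m+n (2 + p) _)) ⟩
          r + m + 2 * (2 + p)            ≤⟨ D≤n ⟩
          n                              ∎) ⟩
        n ∸ (1 + p)                      ≡⟨ cong (n ∸_) ∣A∣≡ ⟨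
        n ∸ ∣ A ∣                        ≡⟨ ∣∁p∣≡n∸∣p∣ A ⟨
        ∣ ∁ A ∣                          ≡⟨ length-elements (∁ A) ⟨
        length (elements (∁ A))          ≡⟨ length-map f (elements (∁ A)) ⟨
        length (map f (elements (∁ A)))  ∎
        where open ≤-Reasoning

      S-completion : ∀ {x} → x ∉ A → f x < r + m → ∃[ j ] S j ≡ A ∪ ⁅ x ⁆
      S-completion x∉A fx<D = low-degree⇒S ∣A∣≡ x∉A (<-≤-trans (+-monoˡ-< _ fx<D) D≤n)

      few : ∀ L → Unique L → (∀ {x} → x ∈ₗ L → x ∉ A × f x < r + m) → ¬ (r ≤ length L)
      few [] _ _ r≤0 = contradiction 1≤r (<⇒≱ (s≤s r≤0))
      -- Now r ≤ 1, so the threshold r + m is at most m + 1, the exact degree of `S j`.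
      few (x ∷ []) _ low r≤1 =
        let x∉A , fx<D = low (here refl)
            j , Sj≡    = S-completion x∉A fx<D
        in <-irrefl (trans (cong (degree G) (sym Sj≡)) (retained j)) (<-≤-trans fx<D (+-monoˡ-≤ m r≤1))
      few (x ∷ y ∷ L) ((x≢y ∷ _) ∷ _) low _ =
        let x∉A , fx<D = low (here refl)
            y∉A , fy<D = low (there (here refl))
        in x≢y (S-completion-unique ∣A∣≡ x∉A (proj₂ (S-completion x∉A fx<D))
                (proj₂ (S-completion y∉A fy<D)))

  -- Minimal labels of disjoint sets.

  ⟨$⟩ʳ-injective : ∀ {n} (π : Permutation′ n) {x y} → π ⟨$⟩ʳ x ≡ π ⟨$⟩ʳ y → x ≡ y
  ⟨$⟩ʳ-injective π eq = trans (sym (inverseˡ π)) (trans (cong (π ⟨$⟩ˡ_) eq) (inverseˡ π))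

  -- `min` returns its default `n` or a listed label; the strict bound excludes the default.
  minLabel-attained : ∀ {n} (π : Permutation′ n) (T : Subset n) → minLabel π T < n →
    ∃[ v ] v ∈ T × label π v ≡ minLabel π T
  minLabel-attained {n} π T min<n with argmin-sel id n (map (label π) (elements T))
  ... | inj₁ min≡n = contradiction min≡n (<⇒≢ min<n)
  ... | inj₂ min∈ = let v , v∈ , min≡ = ∈-map⁻ (label π) min∈ in v , ∈-elements⁻ v∈ , sym min≡

  -- Otherwise more than `m` sets would have minimal labels among 1, ..., `m`; two would share a
  -- label, hence a vertex.
  minLabels-unbounded : ∀ {n t m} (π : Permutation′ n) (S : Fin t → Subset n) → PairwiseDisjoint S →
    m < n → m < t → ¬ (∀ j → minLabel π (S j) ≤ m)
  minLabels-unbounded {n} {t} {m} π S disjointS m<n m<t min≤m =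
    let i , j , i<j , same = Fin.pigeonhole m<t (λ j → Fin.fromℕ< (bound j))
        vᵢ≡vⱼ = ⟨$⟩ʳ-injective π (Fin.toℕ-injective (Fin.fromℕ<-injective _ _ (bound i) (bound j) same))
    in disjointS i j (Fin.<⇒≢ i<j)
         (v j , x∈p∩q⁺ (subst (_∈ S i) vᵢ≡vⱼ (v∈S i) , v∈S j))
    where
    attained = λ j → minLabel-attained π (S j) (≤-<-trans (min≤m j) m<n)
    v : Fin t → Fin n
    v j = proj₁ (attained j)
    v∈S : ∀ j → v j ∈ S j
    v∈S j = proj₁ (proj₂ (attained j))
    -- Labels start at 1, so a label at most `m` is an index strictly below `m`.
    bound : ∀ j → toℕ (π ⟨$⟩ʳ v j) < m
    bound j = subst (_≤ m) (sym (proj₂ (proj₂ (attained j)))) (min≤m j)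

-- Size inequalities over the natural numbers.

module Arithmetic where

  open import Data.Nat.Base using (suc; _≤_; _<_; _+_; _*_; _∸_)
  open import Data.Nat.Properties
  open import Data.Nat.Solver using (module +-*-Solver)
  open import Relation.Binary.PropositionalEquality using (refl; cong)

  -- Here `m` is ⌈αn⌉ - 1. As k ≥ 3, ten times the left side is at most 10km + 40k ≤ n + 4n; the
  -- term added in the first step is the exact slack.
  size-bound : ∀ p m n → 10 * (3 + p) ≤ n → m * (10 * (3 + p)) < n → 2 * suc m + 3 * (3 + p) ≤ n
  size-bound p m n 10k≤n 10km<n = *-cancelˡ-≤ 10 (begin
    10 * (2 * suc m + 3 * k)                  ≤⟨ m≤m+n _ (10 * m + 10 * m * p + (10 + 10 * p)) ⟩
    10 * (2 * suc m + 3 * k) + (10 * m + 10 * m * p + (10 + 10 * p))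
      ≡⟨ solve 2 (λ p m → con 10 :* (con 2 :* (con 1 :+ m) :+ con 3 :* (con 3 :+ p))
            :+ (con 10 :* m :+ con 10 :* m :* p :+ (con 10 :+ con 10 :* p))
            := m :* (con 10 :* (con 3 :+ p)) :+ con 4 :* (con 10 :* (con 3 :+ p))) refl p m ⟩
    m * (10 * k) + 4 * (10 * k)               ≤⟨ +-mono-≤ (<⇒≤ 10km<n) (*-monoʳ-≤ 4 10k≤n) ⟩
    5 * n                                     ≤⟨ *-monoˡ-≤ n (m≤m+n 5 5) ⟩
    10 * n                                    ∎)
    where
    open ≤-Reasoning
    open +-*-Solver
    k = 3 + p

  -- Adding 2r + 1 ≤ n - k + 2 and 2m + 3k ≤ n gives the doubled claim with room to spare; the
  -- offset 5 is (4k + 1) - 4(k - 1).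
  rank-bound : ∀ p m n r → 2 * m + 3 * (3 + p) ≤ n → r * 2 < n ∸ (3 + p) + 2 →
    r + m + 2 * (2 + p) ≤ n
  rank-bound p m n r size 2r<n-k+2 = *-cancelˡ-≤ 2 (+-cancelʳ-≤ 5 _ _ (begin
    2 * (r + m + 2 * (2 + p)) + 5
      ≡⟨ solve 3 (λ p m r → con 2 :* (r :+ m :+ con 2 :* (con 2 :+ p)) :+ con 5
           := con 1 :+ r :* con 2 :+ (con 3 :+ p) :+ (con 2 :* m :+ con 3 :* (con 3 :+ p))) refl p m r ⟩
    suc (r * 2) + k + (2 * m + 3 * k)  ≤⟨ +-mono-≤ (+-monoˡ-≤ k 2r<n-k+2) size ⟩
    n ∸ k + 2 + k + n                  ≡⟨
      solve 3 (λ x k n → x :+ con 2 :+ k :+ n := x :+ k :+ n :+ con 2) refl (n ∸ k) k n ⟩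
    n ∸ k + k + n + 2                  ≡⟨ cong (λ x → x + n + 2) (m∸n+n≡m k≤n) ⟩
    n + n + 2                          ≡⟨ solve 1 (λ n → n :+ n :+ con 2 := con 2 :* n :+ con 2) refl n ⟩
    2 * n + 2                          ≤⟨ +-monoʳ-≤ (2 * n) (m≤m+n 2 3) ⟩
    2 * n + 5                          ∎))
    where
    open ≤-Reasoning
    open +-*-Solver
    k = 3 + p
    k≤n : k ≤ n
    k≤n = ≤-trans (≤-trans (m≤m+n k (k + (k + 0))) (m≤n+m (3 * k) (2 * m))) size

  -- This says m + 1 ≤ (n - k + 2)/2: the degree of S_j does not exceed the half-size term, so in
  -- claim (2) only the minimal label can be the smaller one.
  half-size-bound : ∀ k m n → 2 * m + 3 * k ≤ n → suc m * 2 ≤ n ∸ k + 2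
  half-size-bound k m n size = begin
    2 + m * 2  ≡⟨ +-comm 2 (m * 2) ⟩
    m * 2 + 2  ≡⟨ cong (_+ 2) (*-comm m 2) ⟩
    2 * m + 2  ≤⟨ +-monoˡ-≤ 2 (m+n≤o⇒m≤o∸n (2 * m)
                    (≤-trans (+-monoʳ-≤ (2 * m) (m≤m+n k (2 * k))) size)) ⟩
    n ∸ k + 2  ∎
    where open ≤-Reasoning

-- From real and rational hypotheses to natural numbers.

module RealBounds where

  open import Data.Integer.Base as ℤ using (+_)
  import Data.Integer.Properties as ℤ
  import Data.Nat.Base as ℕ
  import Data.Nat.Properties as ℕ
  open import Data.Nat.Base using (ℕ; suc)
  open import Data.Product.Base using (_,_)
  open import Data.Rational as ℚ using (0ℚ; 1ℚ; _/_; _+_; _*_; _-_; -_; _<_; _≤_)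
  import Data.Rational.Properties as ℚ
  open import Data.Rational.Unnormalised.Base as ℚᵘ using (mkℚᵘ; *≡*; *≤*)
  import Data.Rational.Unnormalised.Properties as ℚᵘ
  open import Data.Sum.Base as Sum using (_⊎_)
  open import Relation.Binary.PropositionalEquality

  -- Rationals are stored in lowest terms, so cross-multiplication passes through the equivalent
  -- unnormalised fractions.
  /-cancel-< : ∀ a b c d → + a / suc b < + c / suc d → a ℕ.* suc d ℕ.< c ℕ.* suc b
  /-cancel-< a b c d lt = ℤ.drop‿+<+ (subst₂ ℤ._<_
    (sym (ℤ.pos-* a (suc d))) (sym (ℤ.pos-* c (suc b)))
    (ℚᵘ.drop-*<* (ℚᵘ.<-respˡ-≃ (ℚ.toℚᵘ-fromℚᵘ (mkℚᵘ (+ a) b))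
      (ℚᵘ.<-respʳ-≃ (ℚ.toℚᵘ-fromℚᵘ (mkℚᵘ (+ c) d)) (ℚ.toℚᵘ-mono-< lt)))))

  fromℕ-mono-≤ : ∀ {a b} → a ℕ.≤ b → fromℕ a ≤ fromℕ b
  fromℕ-mono-≤ {a} {b} a≤b = ℚ.toℚᵘ-cancel-≤
    (ℚᵘ.≤-respˡ-≃ (ℚᵘ.≃-sym (ℚ.toℚᵘ-fromℚᵘ (mkℚᵘ (+ a) 0)))
      (ℚᵘ.≤-respʳ-≃ (ℚᵘ.≃-sym (ℚ.toℚᵘ-fromℚᵘ (mkℚᵘ (+ b) 0)))
       (*≤* (ℤ.*-monoʳ-≤-nonNeg (+ 1) (ℤ.+≤+ a≤b)))))

  fromℕ-cancel-< : ∀ a b → fromℕ a < fromℕ b → a ℕ.< b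
  fromℕ-cancel-< a b lt = subst₂ ℕ._<_ (ℕ.*-identityʳ a) (ℕ.*-identityʳ b) (/-cancel-< a 0 b 0 lt)

  fromℕ-+ : ∀ a b → fromℕ a + fromℕ b ≡ fromℕ (a ℕ.+ b)
  fromℕ-+ a b = ℚ.toℚᵘ-injective (begin
    ℚ.toℚᵘ (fromℕ a + fromℕ b) ≈⟨ ℚ.toℚᵘ-homo-+ (fromℕ a) (fromℕ b) ⟩
    ℚ.toℚᵘ (fromℕ a) ℚᵘ.+ ℚ.toℚᵘ (fromℕ b) ≈⟨
      ℚᵘ.+-cong (ℚ.toℚᵘ-fromℚᵘ (mkℚᵘ (+ a) 0)) (ℚ.toℚᵘ-fromℚᵘ (mkℚᵘ (+ b) 0)) ⟩
    mkℚᵘ (+ a) 0 ℚᵘ.+ mkℚᵘ (+ b) 0 ≈⟨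
      *≡* (cong (ℤ._* + 1) (cong₂ ℤ._+_ (ℤ.*-identityʳ (+ a)) (ℤ.*-identityʳ (+ b)))) ⟩
    mkℚᵘ (+ (a ℕ.+ b)) 0 ≈⟨ ℚ.toℚᵘ-fromℚᵘ (mkℚᵘ (+ (a ℕ.+ b)) 0) ⟨
    ℚ.toℚᵘ (fromℕ (a ℕ.+ b)) ∎)
    where open ℚᵘ.≃-Reasoning

  1/*fromℕ : ∀ d n → + 1 / suc d * fromℕ n ≡ + n / suc d
  1/*fromℕ d n = ℚ.toℚᵘ-injective (begin
    ℚ.toℚᵘ (+ 1 / suc d * fromℕ n) ≈⟨ ℚ.toℚᵘ-homo-* (+ 1 / suc d) (fromℕ n) ⟩
    ℚ.toℚᵘ (+ 1 / suc d) ℚᵘ.* ℚ.toℚᵘ (fromℕ n) ≈⟨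
      ℚᵘ.*-cong (ℚ.toℚᵘ-fromℚᵘ (mkℚᵘ (+ 1) d)) (ℚ.toℚᵘ-fromℚᵘ (mkℚᵘ (+ n) 0)) ⟩
    mkℚᵘ (+ 1) d ℚᵘ.* mkℚᵘ (+ n) 0 ≈⟨
      *≡* (cong₂ ℤ._*_ (ℤ.*-identityˡ (+ n)) (cong (λ e → + suc e) (sym (ℕ.*-identityʳ d)))) ⟩
    mkℚᵘ (+ n) d ≈⟨ ℚ.toℚᵘ-fromℚᵘ (mkℚᵘ (+ n) d) ⟨
    ℚ.toℚᵘ (+ n / suc d) ∎)
    where open ℚᵘ.≃-Reasoning

  p-q<r⇒p<q+r : ∀ p q r → p - q < r → p < q + r
  p-q<r⇒p<q+r p q r lt = subst (_< q + r) eq (ℚ.+-monoʳ-< q lt)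
    where
    eq : q + (p - q) ≡ p
    eq = trans (ℚ.+-comm q (p - q)) (trans (ℚ.+-assoc p (- q) q)
           (trans (cong (λ z → p + z) (ℚ.+-inverseˡ q)) (ℚ.+-identityʳ p)))

  p+1≤q⇒p<q : ∀ p q → p + 1ℚ ≤ q → p < q
  p+1≤q⇒p<q p _ p+1≤q = ℚ.<-≤-trans
    (subst (_< p + 1ℚ) (ℚ.+-identityʳ p) (ℚ.+-monoʳ-< p (ℚ.positive⁻¹ 1ℚ))) p+1≤q

  fromℕ-nonNeg : ∀ n → ℚ.NonNegative (fromℕ n)
  fromℕ-nonNeg n = ℚ.normalize-nonNeg n 1

  -- A lower witness `a` of α lies below the rational separating α from 1/(d + 1). Multiplying by
  -- `n` keeps only a weak inequality, as `n` may be 0; strictness comes from `q<`.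
  ·-upper-bound : ∀ {α d} → α <ᴿ fromℚ (+ 1 / suc d) → ∀ n {q} → lower (α · n) q → q < + n / suc d
  ·-upper-bound {α} {d} (s , us , s<) n (a , la , q<) = ℚ.<-≤-trans q<
    (subst (a * fromℕ n ≤_) (1/*fromℕ d n)
      (ℚ.*-monoʳ-≤-nonNeg (fromℕ n) {{fromℕ-nonNeg n}} (ℚ.<⇒≤ (ℚ.<-trans (lower<upper α la us) s<))))

  -- From m + 1 = ⌈αn⌉ < 1 + αn follows m < αn, while αn ≤ n/(d + 1).
  ceiling-upper-bound : ∀ {α d n m} → α <ᴿ fromℚ (+ 1 / suc d) → IsCeiling (α · n) (suc m) →
    m ℕ.* suc d ℕ.< n
  ceiling-upper-bound {α} {d} {n} {m} α< (_ , q , m<q , lq) = subst (m ℕ.* suc d ℕ.<_) (ℕ.*-identityʳ n)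
    (/-cancel-< m 0 n d (ℚ.≤-<-trans m≤q-1 (·-upper-bound {α} α< n lq)))
    where
    m≤q-1 : fromℕ m ≤ q - 1ℚ
    m≤q-1 = ℚ.≮⇒≥ λ lt → ℚ.<-asym m<q (subst (q <_) (fromℕ-+ 1 m) (p-q<r⇒p<q+r q 1ℚ (fromℕ m) lt))

  ceiling-positive : ∀ {α n m} → fromℚ 0ℚ <ᴿ α → 1 ℕ.≤ n → IsCeiling (α · n) m → 1 ℕ.≤ m
  ceiling-positive {α} {n@(suc n-1)} {m} (q , 0<q , lq) _ (αn≤m , _) = fromℕ-cancel-< 0 m
    (αn≤m 0ℚ (q , lq , subst (_< q * fromℕ n) (ℚ.*-zeroˡ (fromℕ n))
      (ℚ.*-monoˡ-<-pos (fromℕ n) {{fromℕ-pos n-1}} 0<q)))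

  cap-natural : ∀ {k n} → k ℕ.≤ n → ∀ l → cap k n l ≡ fromℕ l ℚ.⊓ (+ (n ℕ.∸ k ℕ.+ 2) / 2)
  cap-natural {k} {n} k≤n l = cong (λ z → fromℕ l ℚ.⊓ ((z ℤ.+ + 2) / 2))
    (trans (ℤ.m-n≡m⊖n n k) (ℤ.⊖-≥ k≤n))

  <cap⇒2*< : ∀ {k n} → k ℕ.≤ n → ∀ l r → fromℕ r < cap k n l → r ℕ.* 2 ℕ.< n ℕ.∸ k ℕ.+ 2
  <cap⇒2*< {k} {n} k≤n l r r<cap = subst (r ℕ.* 2 ℕ.<_) (ℕ.*-identityʳ N)
    (/-cancel-< r 0 N 1 (ℚ.<-≤-trans (subst (fromℕ r <_) (cap-natural k≤n l) r<cap)
      (ℚ.p⊓q≤q (fromℕ l) (+ N / 2))))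
    where N = n ℕ.∸ k ℕ.+ 2

  -- The minimum equals one of its two arguments, and the added 1 makes its comparison with `d`
  -- strict.
  cap+1≤⇒ : ∀ {k n} → k ℕ.≤ n → ∀ l d → cap k n l + 1ℚ ≤ fromℕ d →
    l ℕ.< d ⊎ n ℕ.∸ k ℕ.+ 2 ℕ.< d ℕ.* 2
  cap+1≤⇒ {k} {n} k≤n l d cap+1≤d = Sum.map
    (λ eq → fromℕ-cancel-< l d (subst (_< fromℕ d) eq min<d))
    (λ eq → subst (ℕ._< d ℕ.* 2) (ℕ.*-identityʳ N) (/-cancel-< N 1 d 0 (subst (_< fromℕ d) eq min<d)))
    (ℚ.⊓-sel (fromℕ l) (+ N / 2))
    where
    N = n ℕ.∸ k ℕ.+ 2
    min<d : fromℕ l ℚ.⊓ (+ N / 2) < fromℕ d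
    min<d = subst (_< fromℕ d) (cap-natural k≤n l) (p+1≤q⇒p<q (cap k n l) (fromℕ d) cap+1≤d)

  -- Since x ≤ ⌈x⌉ = m, a natural inequality with m in place of x suffices; this reduces claim (1)
  -- to r + ⌈αn⌉ ≤ c_r(A).
  ⊕-ceiling-≤ : ∀ {x m} r c → IsCeiling x m → r ℕ.+ m ℕ.≤ c → fromℕ r ⊕ x ≤ᴿ fromℚ (fromℕ c)
  ⊕-ceiling-≤ {m = m} r c (x≤m , _) r+m≤c q q-r<x = ℚ.<-≤-trans
    (subst (q <_) (fromℕ-+ r m) (p-q<r⇒p<q+r q (fromℕ r) (fromℕ m) (x≤m (q - fromℕ r) q-r<x)))
    (fromℕ-mono-≤ r+m≤c)

-- Assembling the two claims.

open import Data.Nat.Base using (ℕ; suc; _≤_; _∸_) renaming (_*_ to _*ℕ_)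
open import Data.Rational using (0ℚ; 1ℚ; _+_) renaming (_<_ to _<ℚ_; _≤_ to _≤ℚ_)
open import Data.Fin.Base using (Fin)
open import Data.Fin.Permutation using (Permutation′)
open import Data.Fin.Subset using (Subset; ∣_∣)
open import Data.Product.Base using (∃-syntax; _×_)
open import Relation.Binary.PropositionalEquality using (_≡_)
open import Relation.Nullary using (¬_)
open Combinatorics
open Arithmetic
open RealBounds

open import Data.Nat.Base using (zero; z≤n; s≤s; s≤s⁻¹; z<s)
open import Data.Nat.Properties using (≤-trans; <-≤-trans; m≤m+n; m<m+n; m+n≤o⇒m≤o; ≤⇒≯)
open import Data.Product.Base using (_,_)
open import Data.Sum.Base using (inj₁; inj₂)
open import Function.Base using (case_of_)
open import Relation.Binary.PropositionalEquality using (refl; subst)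
open import Relation.Nullary using (contradiction)

proposition4p2 : (k : ℕ) (3≤k : 3 ≤ k) (α : ℝ) → fromℚ 0ℚ <ᴿ α → α <ᴿ fromℚ (1/10· k by 3≤k) →
    ∃[ n₀ ] ((n : ℕ) → n₀ ≤ n →
    (m : ℕ) → IsCeiling (α · n) m →
    (S : Fin (2 *ℕ m) → Subset n) → (∀ j → ∣ S j ∣ ≡ k ∸ 1) → PairwiseDisjoint S →
    (G : KGraph k n) → Retains S (suc m) G →
    ((π : Permutation′ n) (A : Subset n) → ∣ A ∣ ≡ k ∸ 2 →
    (r : ℕ) → 1 ≤ r → fromℕ r <ℚ cap k n (minLabel π A) →
    fromℕ r ⊕ α · n ≤ᴿ fromℚ (fromℕ (c G r A)))
    ×
    ¬ (∃[ π ] ((T : Subset n) → ∣ T ∣ ≡ k ∸ 1 →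
    cap k n (minLabel {n} π T) + 1ℚ ≤ℚ fromℕ (degree G T))))
-- The threshold 10k, with ⌈αn⌉ - 1 < n/(10k), yields 2⌈αn⌉ + 3k ≤ n, which drives both claims.
proposition4p2 k@(suc (suc (suc p))) 3≤k@(s≤s (s≤s (s≤s z≤n))) α 0<α α<1/10k = 10 *ℕ k , main
  where
  main : ∀ n → 10 *ℕ k ≤ n → _
  main n 10k≤n zero isCeiling S ∣S∣≡ disjointS G retains =
    contradiction (ceiling-positive {α} {m = 0} 0<α (≤-trans (s≤s z≤n) 10k≤n) isCeiling) λ()
  main n 10k≤n m@(suc m-1) isCeiling S ∣S∣≡ disjointS G retains =
      (λ π A ∣A∣≡ r 1≤r r<cap → ⊕-ceiling-≤ {α · n} r (c G r A) isCeiling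
        (c-lower-bound S ∣S∣≡ disjointS G retains refl ∣A∣≡ 1≤r
          (rank-bound p m n r size (<cap⇒2*< k≤n (minLabel π A) r r<cap))))
    -- Applied to S_j, of degree m + 1, the supposed condition forces a minimal label at most m, for
    -- all 2m > m indices j.
    , λ (π , cap<degree) → minLabels-unbounded π S disjointS m<n (m<m+n m z<s) λ j →
        case cap+1≤⇒ k≤n (minLabel π (S j)) (suc m)
               (subst (λ e → cap k n (minLabel π (S j)) + 1ℚ ≤ℚ fromℕ e)
                 (Retains.retained retains j) (cap<degree (S j) (∣S∣≡ j))) of λ where
          (inj₁ min<1+m)     → s≤s⁻¹ min<1+m
          (inj₂ n-k+2<2m+2) → contradiction n-k+2<2m+2 (≤⇒≯ (half-size-bound k m n size))
    where
    size = size-bound p m-1 n 10k≤n (ceiling-upper-bound {α} {m = m-1} α<1/10k isCeiling)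
    k≤n  = ≤-trans (m≤m+n k _) 10k≤n
    m<n  = <-≤-trans (m<m+n m z<s) (m+n≤o⇒m≤o (2 *ℕ m) size)
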